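{- Let $G=(V,E,I,\varsigma,\omega,\sigma)$ be an oriented hypergraph with incidence dual $G^*$. Then $$x^{|E|}\,\chi(\mathbf{L}_G,x)=x^{|V|}\,\chi(\mathbf{L}_{G^*},x),$$ where $\chi(\mathbf{L},x)=\det(xI-\mathbf{L})$ is the (traditional) characteristic polynomial of the Laplacian.
   Context: An oriented hypergraph is a sextuple $G=(V,E,I,\varsigma,\omega,\sigma)$ with finite sets $V$ (vertices), $E$ (edges), $I$ (incidences) and functions $\varsigma:I\to V$ (port), $\omega:I\to E$ (attachment), $\sigma:I\to\{+1,-1\}$ (incidence signs). Several incidences may have the same port and attachment. The incidence dual of $G$ is $G^*=(E,V,I,\omega,\varsigma,\sigma)$. The incidence matrix $\mathbf{H}_G$ is the $V\times E$ matrix whose $(v,e)$-entry is the sum of $\sigma(i)$ over all $i\in I$ with $\varsigma(i)=v$, $\omega(i)=e$. The Laplacian is $\mathbf{L}_G=\mathbf{H}_G\mathbf{H}_G^{T}$; thus $\mathbf{L}_{G}$ is a $V\times V$ matrix and the dual Laplacian $\mathbf{L}_{G^*}$ (also written $\mathbf{L}_G^*$) is an $E\times E$ matrix. -}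

module Defs where

open import Algebra.Bundles.Raw using (RawRing)
import Algebra.Definitions.RawMonoid as RawMonoidDefs
import Algebra.Definitions.RawSemiring as RawSemiringDefs
open import Data.Bool.Base using (if_then_else_; _∧_)
open import Data.Fin.Base using (Fin; zero; suc; punchIn)
open import Data.Fin.Properties using (inj⇒≟)
open import Data.Integer.Base as ℤ using (ℤ; 0ℤ; 1ℤ; _◃_; +-*-rawRing)
open import Data.List.Base using (List; []; _∷_; map)
open import Data.Nat.Base using (ℕ; zero; suc)
open import Data.Sign.Base using (Sign)
open import Function.Base using (flip)
open import Function.Bundles using (_↔_; Inverse)
open import Function.Properties.Inverse using (↔⇒↣)
open import Level using (Level; 0ℓ)
open import Relation.Binary.Definitions using (DecidableEquality)
open import Relation.Binary.PropositionalEquality.Core using (_≡_)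
open import Relation.Nullary.Decidable.Core using (does)

record FiniteSet : Set₁ where
  field
    Elem  : Set
    ∣_∣   : ℕ
    index : Elem ↔ Fin ∣_∣

  element : Fin ∣_∣ → Elem
  element = Inverse.from index

  infix 4 _≟_
  _≟_ : DecidableEquality Elem
  _≟_ = inj⇒≟ (↔⇒↣ index)

open FiniteSet public using (Elem; ∣_∣)

module Matrices {c ℓ : Level} (R : RawRing c ℓ) where
  open RawRing R
  open RawMonoidDefs +-rawMonoid using (sum)

  Matrix : FiniteSet → FiniteSet → Set c
  Matrix A B = Elem A → Elem B → Carrier

  ∑ : (A : FiniteSet) → (Elem A → Carrier) → Carrier
  ∑ A f = sum λ k → f (FiniteSet.element A k)

  _ᵀ : {A B : FiniteSet} → Matrix A B → Matrix B A
  M ᵀ = flip M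

  mul : {A B C : FiniteSet} → Matrix A B → Matrix B C → Matrix A C
  mul {B = B} M N a c = ∑ B λ b → M a b * N b c

  identity : (A : FiniteSet) → Matrix A A
  identity A a b = if does (FiniteSet._≟_ A a b) then 1# else 0#

  alternatingSum : {n : ℕ} → (Fin n → Carrier) → Carrier
  alternatingSum {zero}  f = 0#
  alternatingSum {suc n} f = f zero + - alternatingSum (λ k → f (suc k))

  -- Cofactor expansion along the first row.
  detFin : (n : ℕ) → (Fin n → Fin n → Carrier) → Carrier
  detFin zero    M = 1#
  detFin (suc n) M =
    alternatingSum λ j → M zero j * detFin n (λ i k → M (suc i) (punchIn j k))

  det : (A : FiniteSet) → Matrix A A → Carrier
  det A M = detFin ∣ A ∣ λ i j → M (FiniteSet.element A i) (FiniteSet.element A j)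

-- Elements of ℤ[x] as coefficient lists, constant term first.  Trailing zeros
-- are allowed, so equality of polynomials is _≋_ rather than _≡_.
Poly : Set
Poly = List ℤ

coeff : Poly → ℕ → ℤ
coeff []      k       = 0ℤ
coeff (a ∷ p) zero    = a
coeff (a ∷ p) (suc k) = coeff p k

infix 4 _≋_
record _≋_ (p q : Poly) : Set where
  constructor mk≋
  field
    coeff-≡ : (k : ℕ) → coeff p k ≡ coeff q k

infixl 6 _⊕_
_⊕_ : Poly → Poly → Poly
[]      ⊕ q       = q
(a ∷ p) ⊕ []      = a ∷ p
(a ∷ p) ⊕ (b ∷ q) = (a ℤ.+ b) ∷ (p ⊕ q)

infixl 7 _⊛_
_⊛_ : Poly → Poly → Poly
[]      ⊛ q = []
(a ∷ p) ⊛ q = map (a ℤ.*_) q ⊕ (0ℤ ∷ (p ⊛ q))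

⊖_ : Poly → Poly
⊖_ = map (ℤ.-_)

const : ℤ → Poly
const a = a ∷ []

x : Poly
x = 0ℤ ∷ 1ℤ ∷ []

ℤ[x] : RawRing 0ℓ 0ℓ
ℤ[x] = record
  { Carrier = Poly
  ; _≈_     = _≋_
  ; _+_     = _⊕_
  ; _*_     = _⊛_
  ; -_      = ⊖_
  ; 0#      = []
  ; 1#      = const 1ℤ
  }

open RawSemiringDefs (RawRing.rawSemiring ℤ[x]) public using (_^_)

module Matℤ    = Matrices +-*-rawRing
module Matℤ[x] = Matrices ℤ[x]

χ : (A : FiniteSet) → Matℤ.Matrix A A → Poly
χ A L = Matℤ[x].det A λ a b → x ⊛ Matℤ[x].identity A a b ⊕ ⊖ const (L a b)

record OrientedHypergraph : Set₁ where
  field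
    V E I : FiniteSet
    ς     : Elem I → Elem V
    ω     : Elem I → Elem E
    σ     : Elem I → Sign

open OrientedHypergraph

incidenceDual : OrientedHypergraph → OrientedHypergraph
incidenceDual G = record
  { V = E G
  ; E = V G
  ; I = I G
  ; ς = ω G
  ; ω = ς G
  ; σ = σ G
  }

incidenceMatrix : (G : OrientedHypergraph) → Matℤ.Matrix (V G) (E G)
incidenceMatrix G v e = Matℤ.∑ (I G) λ i →
  if does (ς G i ≟ⱽ v) ∧ does (ω G i ≟ᴱ e) then σ G i ◃ 1 else 0ℤ
  where
  open FiniteSet (V G) using () renaming (_≟_ to _≟ⱽ_)
  open FiniteSet (E G) using () renaming (_≟_ to _≟ᴱ_)

laplacian : (G : OrientedHypergraph) → Matℤ.Matrix (V G) (V G)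
laplacian G = Matℤ.mul {V G} {E G} {V G} H (Matℤ._ᵀ {V G} {E G} H)
  where
  H : Matℤ.Matrix (V G) (E G)
  H = incidenceMatrix G

{-# OPTIONS --safe #-}

-- Write [P Q; S T] for a block matrix and let A be n × m, B be m × n. Adding
-- -A times the bottom rows of [x A; B 1] to the top rows gives [x-AB 0; B 1], so
-- det [x A; B 1] = det (x - AB). Multiplying the bottom rows by x, and then
-- adding -B times the top rows to them, gives [x A; 0 x-BA]. Hence
-- x^m det (x - AB) = det [x A; xB x] = x^n det (x - BA), in any commutative ring.
-- The theorem is the case of ℤ[x], A the incidence matrix and B its transpose.
module Submission where

open import Defs
open import Algebra.Bundles using (CommutativeRing)
open import Algebra.Bundles.Raw using (RawRing)
import Algebra.Definitions.RawMonoid as RawMonoidDefs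
import Algebra.Definitions.RawSemiring as RawSemiringDefs
import Algebra.Properties.CommutativeSemigroup as CommutativeSemigroupProperties
import Algebra.Properties.Ring as RingProperties
import Algebra.Properties.Semiring.Sum as SemiringSum
open import Data.Bool.Base using (if_then_else_)
open import Data.Bool.Properties using (∧-comm)
open import Data.Fin.Base using (Fin; zero; suc; lift; punchIn; _↑ˡ_; _↑ʳ_)
open import Data.Fin.Properties using (_≟_; suc-injective)
open import Data.Integer.Base as ℤ using (ℤ; 0ℤ; 1ℤ; _◃_)
import Data.Integer.Properties as ℤ
open import Data.List.Base using ([]; _∷_; map)
open import Data.Nat.Base as ℕ using (ℕ; zero; suc)
open import Data.Product.Base using (∃; _×_; _,_)
open import Data.Sum.Base using (_⊎_; inj₁; inj₂; [_,_]′)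
open import Data.Vec.Functional using (_++_; head; tail; updateAt) renaming (_∷_ to _◂_)
open import Data.Vec.Functional.Properties using (lookup-++ˡ; lookup-++ʳ; updateAt-updates; updateAt-minimal)
open import Function.Base using (_∘_)
open import Function.Bundles using (Inverse)
open import Level using (0ℓ)
open import Relation.Binary.Bundles using (Setoid)
open import Relation.Binary.PropositionalEquality as ≡ using (_≡_; _≢_; _≗_; cong; cong₂; cong-app)
import Relation.Binary.Reasoning.Setoid as SetoidReasoning
open import Relation.Nullary.Decidable.Core using (does; yes; no)
open import Relation.Nullary.Negation.Core using (contradiction)

-- Clearing a block of [x A; B 1] by means of its scalar block `x` would need a division by `x`.
-- Scaling the bottom rows first makes every coefficient of the row operations an entry of `- A` or
-- `- B`, and the factor x^m is the price of that scaling. The main work lies in justifying row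
-- operations for a determinant that is given only by cofactor expansion along the first row.
-- Linearity in each row follows from the expansion by induction. That two equal rows give zero does
-- not: it comes from expanding along the top two rows and cancelling the two orders in which a pair
-- of columns can be chosen. Antisymmetry alone would show only that twice the determinant vanishes.
-- A block operation changes many rows at once, so it is split into changes of single rows, passing
-- through matrices that mix old and new rows. Polynomials are coefficient lists that may end in
-- zeros, so the ring laws of ℤ[x] are proved up to `_≋_`.

module IntegerPolynomials where
  open _≋_

  -- The commutative ring of integer polynomials.

  ≋-setoid : Setoid 0ℓ 0ℓ
  ≋-setoid = record
    { Carrier       = Poly
    ; _≈_           = _≋_
    ; isEquivalence = record
      { refl  = mk≋ λ _ → ≡.refl
      ; sym   = λ p≋q → mk≋ λ k → ≡.sym (coeff-≡ p≋q k)
      ; trans = λ p≋q q≋r → mk≋ λ k → ≡.trans (coeff-≡ p≋q k) (coeff-≡ q≋r k)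
      }
    }

  open Setoid ≋-setoid using () renaming (refl to ≋-refl; sym to ≋-sym; trans to ≋-trans)

  infixr 7 _·_
  _·_ : ℤ → Poly → Poly
  a · p = map (a ℤ.*_) p

  ∷-cong : ∀ {a b p q} → a ≡ b → p ≋ q → (a ∷ p) ≋ (b ∷ q)
  ∷-cong a≡b p≋q = mk≋ λ { zero → a≡b ; (suc k) → coeff-≡ p≋q k }

  coeff-⊕ : ∀ p q k → coeff (p ⊕ q) k ≡ coeff p k ℤ.+ coeff q k
  coeff-⊕ []      q       k       = ≡.sym (ℤ.+-identityˡ _)
  coeff-⊕ (a ∷ p) []      k       = ≡.sym (ℤ.+-identityʳ _)
  coeff-⊕ (a ∷ p) (b ∷ q) zero    = ≡.refl
  coeff-⊕ (a ∷ p) (b ∷ q) (suc k) = coeff-⊕ p q k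

  coeff-⊖ : ∀ p k → coeff (⊖ p) k ≡ ℤ.- coeff p k
  coeff-⊖ []      k       = ≡.refl
  coeff-⊖ (a ∷ p) zero    = ≡.refl
  coeff-⊖ (a ∷ p) (suc k) = coeff-⊖ p k

  coeff-· : ∀ a p k → coeff (a · p) k ≡ a ℤ.* coeff p k
  coeff-· a []      k       = ≡.sym (ℤ.*-zeroʳ a)
  coeff-· a (b ∷ p) zero    = ≡.refl
  coeff-· a (b ∷ p) (suc k) = coeff-· a p k

  -- Equal polynomials may be lists of different lengths, so a simultaneous recursion on them does
  -- not line up; comparing coefficients avoids it.
  ⊕-cong : ∀ {p p′ q q′} → p ≋ p′ → q ≋ q′ → p ⊕ q ≋ p′ ⊕ q′
  ⊕-cong {p} {p′} {q} {q′} p≋p′ q≋q′ = mk≋ λ k → begin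
    coeff (p ⊕ q) k            ≡⟨ coeff-⊕ p q k ⟩
    coeff p k ℤ.+ coeff q k    ≡⟨ cong₂ ℤ._+_ (coeff-≡ p≋p′ k) (coeff-≡ q≋q′ k) ⟩
    coeff p′ k ℤ.+ coeff q′ k  ≡⟨ coeff-⊕ p′ q′ k ⟨
    coeff (p′ ⊕ q′) k          ∎
    where open ≡.≡-Reasoning

  ⊕-assoc : ∀ p q r → (p ⊕ q) ⊕ r ≋ p ⊕ (q ⊕ r)
  ⊕-assoc []      q       r       = ≋-refl
  ⊕-assoc (a ∷ p) []      r       = ≋-refl
  ⊕-assoc (a ∷ p) (b ∷ q) []      = ≋-refl
  ⊕-assoc (a ∷ p) (b ∷ q) (c ∷ r) = ∷-cong (ℤ.+-assoc a b c) (⊕-assoc p q r)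

  ⊕-comm : ∀ p q → p ⊕ q ≋ q ⊕ p
  ⊕-comm []      []      = ≋-refl
  ⊕-comm []      (b ∷ q) = ≋-refl
  ⊕-comm (a ∷ p) []      = ≋-refl
  ⊕-comm (a ∷ p) (b ∷ q) = ∷-cong (ℤ.+-comm a b) (⊕-comm p q)

  ⊕-identityʳ : ∀ p → p ⊕ [] ≋ p
  ⊕-identityʳ []      = ≋-refl
  ⊕-identityʳ (a ∷ p) = ≋-refl

  ⊖-cong : ∀ {p q} → p ≋ q → ⊖ p ≋ ⊖ q
  ⊖-cong {p} {q} p≋q = mk≋ λ k →
    ≡.trans (coeff-⊖ p k) (≡.trans (cong ℤ.-_ (coeff-≡ p≋q k)) (≡.sym (coeff-⊖ q k)))

  -- The basic identification of lists of different lengths: zeros left behind at the end of a list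
  -- are removed with it one by one.
  0∷[]≋[] : (0ℤ ∷ []) ≋ []
  0∷[]≋[] = mk≋ λ { zero → ≡.refl ; (suc k) → ≡.refl }

  ⊖-inverseˡ : ∀ p → ⊖ p ⊕ p ≋ []
  ⊖-inverseˡ []      = ≋-refl
  ⊖-inverseˡ (a ∷ p) = ≋-trans (∷-cong (ℤ.+-inverseˡ a) (⊖-inverseˡ p)) 0∷[]≋[]

  ⊖-inverseʳ : ∀ p → p ⊕ ⊖ p ≋ []
  ⊖-inverseʳ p = ≋-trans (⊕-comm p (⊖ p)) (⊖-inverseˡ p)

  open SetoidReasoning ≋-setoid

  ⊕-exchange : ∀ p q r → p ⊕ (q ⊕ r) ≋ q ⊕ (p ⊕ r)
  ⊕-exchange p q r = begin
    p ⊕ (q ⊕ r)  ≈⟨ ⊕-assoc p q r ⟨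
    (p ⊕ q) ⊕ r  ≈⟨ ⊕-cong (⊕-comm p q) ≋-refl ⟩
    (q ⊕ p) ⊕ r  ≈⟨ ⊕-assoc q p r ⟩
    q ⊕ (p ⊕ r)  ∎

  ⊕-interchange : ∀ p q r s → (p ⊕ q) ⊕ (r ⊕ s) ≋ (p ⊕ r) ⊕ (q ⊕ s)
  ⊕-interchange p q r s = begin
    (p ⊕ q) ⊕ (r ⊕ s)  ≈⟨ ⊕-assoc p q (r ⊕ s) ⟩
    p ⊕ (q ⊕ (r ⊕ s))  ≈⟨ ⊕-cong (≋-refl {p}) (⊕-exchange q r s) ⟩
    p ⊕ (r ⊕ (q ⊕ s))  ≈⟨ ⊕-assoc p r (q ⊕ s) ⟨
    (p ⊕ r) ⊕ (q ⊕ s)  ∎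

  ·-cong : ∀ a {p q} → p ≋ q → a · p ≋ a · q
  ·-cong a {p} {q} p≋q = mk≋ λ k →
    ≡.trans (coeff-· a p k) (≡.trans (cong (a ℤ.*_) (coeff-≡ p≋q k)) (≡.sym (coeff-· a q k)))

  ·-distribˡ-⊕ : ∀ a p q → a · (p ⊕ q) ≋ a · p ⊕ a · q
  ·-distribˡ-⊕ a []      q       = ≋-refl
  ·-distribˡ-⊕ a (b ∷ p) []      = ≋-refl
  ·-distribˡ-⊕ a (b ∷ p) (c ∷ q) = ∷-cong (ℤ.*-distribˡ-+ a b c) (·-distribˡ-⊕ a p q)

  ·-assoc : ∀ a b p → (a ℤ.* b) · p ≋ a · (b · p)
  ·-assoc a b []      = ≋-refl
  ·-assoc a b (c ∷ p) = ∷-cong (ℤ.*-assoc a b c) (·-assoc a b p)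

  1·-identity : ∀ p → 1ℤ · p ≋ p
  1·-identity []      = ≋-refl
  1·-identity (a ∷ p) = ∷-cong (ℤ.*-identityˡ a) (1·-identity p)

  0·-zero : ∀ p → 0ℤ · p ≋ []
  0·-zero []      = ≋-refl
  0·-zero (a ∷ p) = ≋-trans (∷-cong (ℤ.*-zeroˡ a) (0·-zero p)) 0∷[]≋[]

  ⊛-congʳ : ∀ p {q r} → q ≋ r → p ⊛ q ≋ p ⊛ r
  ⊛-congʳ []      q≋r = ≋-refl
  ⊛-congʳ (a ∷ p) q≋r = ⊕-cong (·-cong a q≋r) (∷-cong ≡.refl (⊛-congʳ p q≋r))

  ⊛-zeroʳ : ∀ p → p ⊛ [] ≋ []
  ⊛-zeroʳ []      = ≋-refl
  ⊛-zeroʳ (a ∷ p) = ≋-trans (∷-cong ≡.refl (⊛-zeroʳ p)) 0∷[]≋[]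

  -- Multiplication recurses on its left factor. This is the mirror recursion on the right factor,
  -- and commutativity follows by comparing the two.
  ⊛-∷ : ∀ p b q → p ⊛ (b ∷ q) ≋ b · p ⊕ (0ℤ ∷ p ⊛ q)
  ⊛-∷ []      b q = ≋-sym 0∷[]≋[]
  ⊛-∷ (a ∷ p) b q = ∷-cong (cong (ℤ._+ 0ℤ) (ℤ.*-comm a b)) (begin
    a · q ⊕ p ⊛ (b ∷ q)             ≈⟨ ⊕-cong (≋-refl {a · q}) (⊛-∷ p b q) ⟩
    a · q ⊕ (b · p ⊕ (0ℤ ∷ p ⊛ q))  ≈⟨ ⊕-exchange (a · q) (b · p) (0ℤ ∷ p ⊛ q) ⟩
    b · p ⊕ (a · q ⊕ (0ℤ ∷ p ⊛ q))  ∎)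

  ⊛-comm : ∀ p q → p ⊛ q ≋ q ⊛ p
  ⊛-comm []      q = ≋-sym (⊛-zeroʳ q)
  ⊛-comm (a ∷ p) q = begin
    a · q ⊕ (0ℤ ∷ p ⊛ q)  ≈⟨ ⊕-cong (≋-refl {a · q}) (∷-cong ≡.refl (⊛-comm p q)) ⟩
    a · q ⊕ (0ℤ ∷ q ⊛ p)  ≈⟨ ⊛-∷ q a p ⟨
    q ⊛ (a ∷ p)           ∎

  -- Induction handles a change of the right factor only; commutativity transports it to the left
  -- one.
  ⊛-cong : ∀ {p p′ q q′} → p ≋ p′ → q ≋ q′ → p ⊛ q ≋ p′ ⊛ q′
  ⊛-cong {p} {p′} {q} {q′} p≋p′ q≋q′ = begin
    p ⊛ q    ≈⟨ ⊛-congʳ p q≋q′ ⟩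
    p ⊛ q′   ≈⟨ ⊛-comm p q′ ⟩
    q′ ⊛ p   ≈⟨ ⊛-congʳ q′ p≋p′ ⟩
    q′ ⊛ p′  ≈⟨ ⊛-comm q′ p′ ⟩
    p′ ⊛ q′  ∎

  ⊛-distribˡ-⊕ : ∀ p q r → p ⊛ (q ⊕ r) ≋ p ⊛ q ⊕ p ⊛ r
  ⊛-distribˡ-⊕ []      q r = ≋-refl
  ⊛-distribˡ-⊕ (a ∷ p) q r = begin
    a · (q ⊕ r) ⊕ (0ℤ ∷ p ⊛ (q ⊕ r))
      ≈⟨ ⊕-cong (·-distribˡ-⊕ a q r) (∷-cong ≡.refl (⊛-distribˡ-⊕ p q r)) ⟩
    (a · q ⊕ a · r) ⊕ ((0ℤ ∷ p ⊛ q) ⊕ (0ℤ ∷ p ⊛ r))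
      ≈⟨ ⊕-interchange (a · q) (a · r) (0ℤ ∷ p ⊛ q) (0ℤ ∷ p ⊛ r) ⟩
    (a ∷ p) ⊛ q ⊕ (a ∷ p) ⊛ r
      ∎

  ⊛-distribʳ-⊕ : ∀ p q r → (q ⊕ r) ⊛ p ≋ q ⊛ p ⊕ r ⊛ p
  ⊛-distribʳ-⊕ p q r = begin
    (q ⊕ r) ⊛ p    ≈⟨ ⊛-comm (q ⊕ r) p ⟩
    p ⊛ (q ⊕ r)    ≈⟨ ⊛-distribˡ-⊕ p q r ⟩
    p ⊛ q ⊕ p ⊛ r  ≈⟨ ⊕-cong (⊛-comm p q) (⊛-comm p r) ⟩
    q ⊛ p ⊕ r ⊛ p  ∎

  ·-⊛-assoc : ∀ a p q → (a · p) ⊛ q ≋ a · (p ⊛ q)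
  ·-⊛-assoc a []      q = ≋-refl
  ·-⊛-assoc a (b ∷ p) q = begin
    (a ℤ.* b) · q ⊕ (0ℤ ∷ (a · p) ⊛ q)
      ≈⟨ ⊕-cong (·-assoc a b q) (∷-cong (≡.sym (ℤ.*-zeroʳ a)) (·-⊛-assoc a p q)) ⟩
    a · (b · q) ⊕ a · (0ℤ ∷ p ⊛ q)
      ≈⟨ ·-distribˡ-⊕ a (b · q) (0ℤ ∷ p ⊛ q) ⟨
    a · ((b ∷ p) ⊛ q)
      ∎

  ⊛-assoc : ∀ p q r → (p ⊛ q) ⊛ r ≋ p ⊛ (q ⊛ r)
  ⊛-assoc []      q r = ≋-refl
  ⊛-assoc (a ∷ p) q r = begin
    (a · q ⊕ (0ℤ ∷ p ⊛ q)) ⊛ r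
      ≈⟨ ⊛-distribʳ-⊕ r (a · q) (0ℤ ∷ p ⊛ q) ⟩
    -- The shift `0ℤ ∷ p ⊛ q`, multiplied by `r`, unfolds to a sum that starts with the vanishing
    -- term `0ℤ · r`.
    (a · q) ⊛ r ⊕ (0ℤ · r ⊕ (0ℤ ∷ (p ⊛ q) ⊛ r))
      ≈⟨ ⊕-cong (·-⊛-assoc a q r) (⊕-cong (0·-zero r) (∷-cong ≡.refl (⊛-assoc p q r))) ⟩
    a · (q ⊛ r) ⊕ (0ℤ ∷ p ⊛ (q ⊛ r))
      ∎

  ⊛-identityˡ : ∀ p → const 1ℤ ⊛ p ≋ p
  ⊛-identityˡ p = begin
    1ℤ · p ⊕ (0ℤ ∷ [])  ≈⟨ ⊕-cong (1·-identity p) 0∷[]≋[] ⟩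
    p ⊕ []              ≈⟨ ⊕-identityʳ p ⟩
    p                   ∎

  ℤ[x]-commutativeRing : CommutativeRing 0ℓ 0ℓ
  ℤ[x]-commutativeRing = record
    { Carrier = Poly
    ; _≈_     = _≋_
    ; _+_     = _⊕_
    ; _*_     = _⊛_
    ; -_      = ⊖_
    ; 0#      = []
    ; 1#      = const 1ℤ
    ; isCommutativeRing = record
      { isRing = record
        { +-isAbelianGroup = record
          { isGroup = record
            { isMonoid = record
              { isSemigroup = record
                { isMagma = record
                  { isEquivalence = Setoid.isEquivalence ≋-setoid
                  ; ∙-cong        = ⊕-cong
                  }
                ; assoc = ⊕-assoc
                }
              ; identity = (λ p → ≋-refl) , ⊕-identityʳ
              }
            ; inverse = ⊖-inverseˡ , ⊖-inverseʳ
            ; ⁻¹-cong = ⊖-cong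
            }
          ; comm = ⊕-comm
          }
        ; *-cong     = ⊛-cong
        ; *-assoc    = ⊛-assoc
        ; *-identity = ⊛-identityˡ , λ p → ≋-trans (⊛-comm p (const 1ℤ)) (⊛-identityˡ p)
        ; distrib    = ⊛-distribˡ-⊕ , ⊛-distribʳ-⊕
        }
      ; *-comm = ⊛-comm
      }
    }

module Determinants {c ℓ} (R : CommutativeRing c ℓ) where
  open CommutativeRing R hiding (zero)
  open Matrices rawRing using (alternatingSum; detFin)
  open RingProperties ring using (-‿+-comm; -‿distribˡ-*; -‿distribʳ-*; -0#≈0#)
  open SemiringSum semiring using (sum; sum-cong-≋; sum-replicate-zero)
  open CommutativeSemigroupProperties +-commutativeSemigroup using (interchange)
  open CommutativeSemigroupProperties *-commutativeSemigroup using (x∙yz≈y∙xz)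
    renaming (interchange to *-interchange)
  open RawSemiringDefs (RawRing.rawSemiring rawRing) using ()
    renaming (_^_ to _**_)
  open SetoidReasoning setoid

  -- Alternating sums and the cofactor expansion.

  Square : ℕ → Set c
  Square n = Fin n → Fin n → Carrier

  minor : ∀ {n} → Square (suc n) → Fin (suc n) → Square n
  minor M j i k = M (suc i) (punchIn j k)

  -- Opaque, since unification fails once a sum over Fin (suc n) has unfolded.
  opaque
    ±∑ : ∀ {n} → (Fin n → Carrier) → Carrier
    ±∑ = alternatingSum

    ±∑-cong : ∀ {n} {f g : Fin n → Carrier} →
      (∀ k → f k ≈ g k) → ±∑ f ≈ ±∑ g
    ±∑-cong {zero}  f≈g = refl
    ±∑-cong {suc n} f≈g =
      +-cong (f≈g zero) (-‿cong (±∑-cong (f≈g ∘ suc)))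

    ±∑-zero : ∀ {n} {f : Fin n → Carrier} →
      (∀ k → f k ≈ 0#) → ±∑ f ≈ 0#
    ±∑-zero {zero}      f≈0 = refl
    ±∑-zero {suc n} {f} f≈0 = begin
      f zero + - ±∑ (f ∘ suc)  ≈⟨ +-cong (f≈0 zero) (-‿cong (±∑-zero (f≈0 ∘ suc))) ⟩
      0# + - 0#                ≈⟨ -‿inverseʳ 0# ⟩
      0#                       ∎

    ±∑-+ : ∀ {n} (f g : Fin n → Carrier) →
      ±∑ (λ k → f k + g k) ≈ ±∑ f + ±∑ g
    ±∑-+ {zero}  f g = sym (+-identityˡ 0#)
    ±∑-+ {suc n} f g = begin
      (f zero + g zero) + - ±∑ (λ k → f (suc k) + g (suc k))
        ≈⟨ +-congˡ (-‿cong (±∑-+ (f ∘ suc) (g ∘ suc))) ⟩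
      (f zero + g zero) + - (±∑ (f ∘ suc) + ±∑ (g ∘ suc))
        ≈⟨ +-congˡ (-‿+-comm _ _) ⟨
      (f zero + g zero) + (- ±∑ (f ∘ suc) + - ±∑ (g ∘ suc))
        ≈⟨ interchange _ _ _ _ ⟩
      ±∑ f + ±∑ g
        ∎

    ±∑-neg : ∀ {n} (f : Fin n → Carrier) →
      ±∑ (λ k → - f k) ≈ - ±∑ f
    ±∑-neg {zero}  f = sym -0#≈0#
    ±∑-neg {suc n} f = begin
      - f zero + - ±∑ (λ k → - f (suc k))  ≈⟨ +-congˡ (-‿cong (±∑-neg (f ∘ suc))) ⟩
      - f zero + - - ±∑ (f ∘ suc)          ≈⟨ -‿+-comm _ _ ⟩
      - ±∑ f                               ∎

    *-distribˡ-±∑ : ∀ {n} a (f : Fin n → Carrier) →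
      a * ±∑ f ≈ ±∑ (λ k → a * f k)
    *-distribˡ-±∑ {zero}  a f = zeroʳ a
    *-distribˡ-±∑ {suc n} a f = begin
      a * (f zero + - ±∑ (f ∘ suc))      ≈⟨ distribˡ a _ _ ⟩
      a * f zero + a * - ±∑ (f ∘ suc)    ≈⟨ +-congˡ (-‿distribʳ-* a _) ⟨
      a * f zero + - (a * ±∑ (f ∘ suc))  ≈⟨ +-congˡ (-‿cong (*-distribˡ-±∑ a (f ∘ suc))) ⟩
      ±∑ (λ k → a * f k)                 ∎

    -- Together with `detFin-expand` this is the interface of the opaque block: both hold by
    -- computation inside it and unfold a sum or a determinant once, on request, outside.
    ±∑-suc : ∀ {n} (f : Fin (suc n) → Carrier) →
      ±∑ f ≈ f zero + - ±∑ (f ∘ suc)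
    ±∑-suc f = refl

    detFin-expand : ∀ {n} (M : Square (suc n)) →
      detFin (suc n) M ≈ ±∑ λ j → M zero j * detFin n (minor M j)
    detFin-expand M = refl

  -- Linearity of the determinant in each row.

  detFin-cong : ∀ {n} {M N : Square n} → (∀ i j → M i j ≈ N i j) → detFin n M ≈ detFin n N
  detFin-cong {zero}  M≈N = refl
  detFin-cong {suc n} {M} {N} M≈N = begin
    detFin (suc n) M
      ≈⟨ detFin-expand M ⟩
    ±∑ (λ j → M zero j * detFin n (minor M j))
      ≈⟨ ±∑-cong (λ j → *-cong (M≈N zero j) (detFin-cong λ i k → M≈N (suc i) (punchIn j k))) ⟩
    ±∑ (λ j → N zero j * detFin n (minor N j))
      ≈⟨ detFin-expand N ⟨
    detFin (suc n) N
      ∎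

  -- For the top row the coefficients split and the minors agree; for a lower row the minors split
  -- by induction and the coefficients agree. Three matrices that agree off row `i` are used because
  -- such hypotheses restrict to minors along `punchIn j`.
  detFin-linear : ∀ {n} (i : Fin n) a {M N P : Square n} →
    (∀ k → M i k ≈ a * N i k + P i k) →
    (∀ j → j ≢ i → ∀ k → M j k ≈ N j k) →
    (∀ j → j ≢ i → ∀ k → M j k ≈ P j k) →
    detFin n M ≈ a * detFin n N + detFin n P
  detFin-linear {suc n} zero a {M} {N} {P} Mᵢ M≈N M≈P = begin
    detFin (suc n) M
      ≈⟨ detFin-expand M ⟩
    ±∑ (λ j → M zero j * detFin n (minor M j))
      ≈⟨ ±∑-cong (λ j → begin
           M zero j * detFin n (minor M j)
             ≈⟨ *-congʳ (Mᵢ j) ⟩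
           (a * N zero j + P zero j) * detFin n (minor M j)
             ≈⟨ distribʳ _ _ _ ⟩
           a * N zero j * detFin n (minor M j) + P zero j * detFin n (minor M j)
             ≈⟨ +-cong
                  (trans (*-assoc _ _ _) (*-congˡ (*-congˡ (detFin-cong λ i k → M≈N (suc i) (λ ()) (punchIn j k)))))
                  (*-congˡ (detFin-cong λ i k → M≈P (suc i) (λ ()) (punchIn j k))) ⟩
           a * (N zero j * detFin n (minor N j)) + P zero j * detFin n (minor P j)
             ∎) ⟩
    ±∑ (λ j → a * (N zero j * detFin n (minor N j)) + P zero j * detFin n (minor P j))
      ≈⟨ ±∑-+ _ _ ⟩
    ±∑ (λ j → a * (N zero j * detFin n (minor N j))) + ±∑ (λ j → P zero j * detFin n (minor P j))
      ≈⟨ +-cong (trans (*-congˡ (detFin-expand N)) (*-distribˡ-±∑ a _)) (detFin-expand P) ⟨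
    a * detFin (suc n) N + detFin (suc n) P
      ∎
  detFin-linear {suc n} (suc i) a {M} {N} {P} Mᵢ M≈N M≈P = begin
    detFin (suc n) M
      ≈⟨ detFin-expand M ⟩
    ±∑ (λ j → M zero j * detFin n (minor M j))
      ≈⟨ ±∑-cong (λ j → begin
           M zero j * detFin n (minor M j)
             ≈⟨ *-congˡ (detFin-linear i a
                  (λ k → Mᵢ (punchIn j k))
                  (λ l l≢i k → M≈N (suc l) (l≢i ∘ suc-injective) (punchIn j k))
                  (λ l l≢i k → M≈P (suc l) (l≢i ∘ suc-injective) (punchIn j k))) ⟩
           M zero j * (a * detFin n (minor N j) + detFin n (minor P j))
             ≈⟨ distribˡ _ _ _ ⟩
           M zero j * (a * detFin n (minor N j)) + M zero j * detFin n (minor P j)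
             ≈⟨ +-cong (x∙yz≈y∙xz _ _ _) (*-congʳ (M≈P zero (λ ()) j)) ⟩
           a * (M zero j * detFin n (minor N j)) + P zero j * detFin n (minor P j)
             ≈⟨ +-congʳ (*-congˡ (*-congʳ (M≈N zero (λ ()) j))) ⟩
           a * (N zero j * detFin n (minor N j)) + P zero j * detFin n (minor P j)
             ∎) ⟩
    ±∑ (λ j → a * (N zero j * detFin n (minor N j)) + P zero j * detFin n (minor P j))
      ≈⟨ ±∑-+ _ _ ⟩
    ±∑ (λ j → a * (N zero j * detFin n (minor N j))) + ±∑ (λ j → P zero j * detFin n (minor P j))
      ≈⟨ +-cong (trans (*-congˡ (detFin-expand N)) (*-distribˡ-±∑ a _)) (detFin-expand P) ⟨
    a * detFin (suc n) N + detFin (suc n) P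
      ∎

  -- The determinant is alternating in its rows.

  -- In the expansion along two rows, the pairs of columns (0 , k + 1) and
  -- (k + 1 , 0) contribute with opposite signs; the pairs (j + 1 , k + 1) form
  -- an expansion of the same shape with one column fewer.
  symmetric-expansion≈0 : ∀ {n} (p : Square (suc (suc n))) → (∀ i j → p i j ≈ p j i) →
    (D : (Fin n → Fin (suc (suc n))) → Carrier) → (∀ {u v} → u ≗ v → D u ≈ D v) →
    ±∑ (λ j → ±∑ λ k →
      p j (punchIn j k) * D (punchIn j ∘ punchIn k)) ≈ 0#
  symmetric-expansion≈0 {n} p p-sym D D-cong = begin
    ±∑ (λ j → ±∑ (h j))
      ≈⟨ ±∑-suc _ ⟩
    ±∑ (h zero) + - ±∑ (λ j → ±∑ (h (suc j)))
      ≈⟨ +-congˡ (-‿cong (trans (±∑-cong λ j → ±∑-suc (h (suc j))) (trans (±∑-+ _ _) (+-congˡ (±∑-neg _))))) ⟩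
    ±∑ (h zero) + - (±∑ (λ j → h (suc j) zero) + - rest n p D)
      ≈⟨ +-congˡ (-‿cong (+-cong (±∑-cong pairs) (-‿cong (rest≈0 n p p-sym D D-cong)))) ⟩
    ±∑ (h zero) + - (±∑ (h zero) + - 0#)
      ≈⟨ +-congˡ (-‿cong (trans (+-congˡ -0#≈0#) (+-identityʳ _))) ⟩
    ±∑ (h zero) + - ±∑ (h zero)
      ≈⟨ -‿inverseʳ _ ⟩
    0#
      ∎
    where
    h : Fin (suc (suc n)) → Fin (suc n) → Carrier
    h j k = p j (punchIn j k) * D (punchIn j ∘ punchIn k)

    pairs : ∀ k → h (suc k) zero ≈ h zero k
    -- Removing column `suc k` and then the first remaining one leaves the same columns, in the same
    -- order, as removing column `zero` and then the `k`-th remaining one.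
    pairs k = *-cong (p-sym (suc k) zero) (D-cong λ _ → ≡.refl)

    rest : ∀ n → Square (suc (suc n)) → ((Fin n → Fin (suc (suc n))) → Carrier) → Carrier
    rest n p D = ±∑ λ (j : Fin (suc n)) → ±∑ λ (k : Fin n) →
      p (suc j) (suc (punchIn j k)) * D (punchIn (suc j) ∘ punchIn (suc k))

    rest≈0 : ∀ n p → (∀ i j → p i j ≈ p j i) → ∀ D → (∀ {u v} → u ≗ v → D u ≈ D v) →
      rest n p D ≈ 0#
    rest≈0 zero    p p-sym D D-cong = ±∑-zero λ _ → ±∑-zero λ ()
    rest≈0 (suc n) p p-sym D D-cong = trans
      (±∑-cong λ j → ±∑-cong λ k →
        -- Both selections fix column `zero` and act on the later ones as `punchIn j ∘ punchIn k`.
        -- Hence the smaller expansion has `D ∘ lift 1` in place of `D`.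
        *-congˡ (D-cong λ { zero → ≡.refl ; (suc l) → ≡.refl }))
      (symmetric-expansion≈0 (λ i j → p (suc i) (suc j)) (λ i j → p-sym (suc i) (suc j))
        (D ∘ lift 1) (λ u≗v → D-cong λ { zero → ≡.refl ; (suc l) → cong suc (u≗v l) }))

  -- A minor as a function of the selected columns: removing two columns in succession becomes a
  -- composite of two `punchIn`, the form in which `symmetric-expansion≈0` takes its `D`.
  columns : ∀ {m n} → (Fin n → Fin m → Carrier) → (Fin n → Fin m) → Carrier
  columns {n = n} M u = detFin n λ i l → M i (u l)

  columns-cong : ∀ {m n} (M : Fin n → Fin m → Carrier) {u v} → u ≗ v → columns M u ≈ columns M v
  columns-cong M u≗v = detFin-cong λ i l → reflexive (cong (M i) (u≗v l))

  two-row-expansion : ∀ {n} (M : Square (suc (suc n))) →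
    detFin (suc (suc n)) M ≈ ±∑ λ j → ±∑ λ k →
      (M zero j * M (suc zero) (punchIn j k)) * columns (tail (tail M)) (punchIn j ∘ punchIn k)
  two-row-expansion {n} M = begin
    detFin (suc (suc n)) M
      ≈⟨ detFin-expand M ⟩
    ±∑ (λ j → M zero j * detFin (suc n) (minor M j))
      ≈⟨ ±∑-cong (λ j → begin
           M zero j * detFin (suc n) (minor M j)
             ≈⟨ *-congˡ (detFin-expand (minor M j)) ⟩
           M zero j * ±∑ (λ k → M (suc zero) (punchIn j k) * D j k)
             ≈⟨ *-distribˡ-±∑ _ _ ⟩
           ±∑ (λ k → M zero j * (M (suc zero) (punchIn j k) * D j k))
             ≈⟨ ±∑-cong (λ k → sym (*-assoc _ _ _)) ⟩
           ±∑ (λ k → (M zero j * M (suc zero) (punchIn j k)) * D j k)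
             ∎) ⟩
    ±∑ (λ j → ±∑ λ k → (M zero j * M (suc zero) (punchIn j k)) * D j k)
      ∎
    where
    D : Fin (suc (suc n)) → Fin (suc n) → Carrier
    D j k = columns (tail (tail M)) (punchIn j ∘ punchIn k)

  swapTop : ∀ {n} → Square (suc (suc n)) → Square (suc (suc n))
  swapTop M = M (suc zero) ◂ M zero ◂ tail (tail M)

  -- Both matrices have the same rows below the top two, so their expansions share the minors
  -- `D j k`. The coefficients add up to a symmetric function of the two columns.
  detFin-swapTop : ∀ {n} (M : Square (suc (suc n))) →
    detFin (suc (suc n)) M + detFin (suc (suc n)) (swapTop M) ≈ 0#
  detFin-swapTop {n} M = begin
    detFin (suc (suc n)) M + detFin (suc (suc n)) (swapTop M)
      ≈⟨ +-cong (two-row-expansion M) (two-row-expansion (swapTop M)) ⟩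
    ±∑ (λ j → ±∑ λ k → (r j * s (punchIn j k)) * D j k) +
    ±∑ (λ j → ±∑ λ k → (s j * r (punchIn j k)) * D j k)
      ≈⟨ ±∑-+ _ _ ⟨
    ±∑ (λ j → ±∑ (λ k → (r j * s (punchIn j k)) * D j k) +
                          ±∑ (λ k → (s j * r (punchIn j k)) * D j k))
      ≈⟨ ±∑-cong (λ j → trans (sym (±∑-+ _ _))
           (±∑-cong λ k → sym (distribʳ _ _ _))) ⟩
    ±∑ (λ j → ±∑ λ k →
      (r j * s (punchIn j k) + s j * r (punchIn j k)) * D j k)
      ≈⟨ symmetric-expansion≈0 (λ i j → r i * s j + s i * r j)
           (λ i j → trans (+-comm _ _) (+-cong (*-comm _ _) (*-comm _ _)))
           (columns (tail (tail M))) (columns-cong (tail (tail M))) ⟩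
    0#
      ∎
    where
    r s : Fin (suc (suc n)) → Carrier
    r = M zero
    s = M (suc zero)

    D : Fin (suc (suc n)) → Fin (suc n) → Carrier
    D j k = columns (tail (tail M)) (punchIn j ∘ punchIn k)

  minors≈0⇒detFin≈0 : ∀ {n} (M : Square (suc n)) →
    (∀ j → detFin n (minor M j) ≈ 0#) → detFin (suc n) M ≈ 0#
  minors≈0⇒detFin≈0 M minors≈0 = trans (detFin-expand M)
    (±∑-zero λ j → trans (*-congˡ (minors≈0 j)) (zeroʳ _))

  -- If the equal rows are adjacent, the coefficients of the two-row expansion are symmetric.
  -- Otherwise swapping the top two rows pushes the first of the equal rows down into the minors,
  -- which vanish by induction.
  detFin-head-equal : ∀ {n} (M : Square (suc n)) i →
    (∀ k → M zero k ≈ M (suc i) k) → detFin (suc n) M ≈ 0#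
  detFin-head-equal {suc n} M zero M₀≈M₁ = begin
    detFin (suc (suc n)) M
      ≈⟨ two-row-expansion M ⟩
    ±∑ (λ j → ±∑ λ k → (M zero j * M (suc zero) (punchIn j k)) * D j k)
      ≈⟨ ±∑-cong (λ j → ±∑-cong λ k → *-congʳ (*-congˡ (sym (M₀≈M₁ _)))) ⟩
    ±∑ (λ j → ±∑ λ k → (M zero j * M zero (punchIn j k)) * D j k)
      ≈⟨ symmetric-expansion≈0 (λ i j → M zero i * M zero j) (λ i j → *-comm _ _)
           (columns (tail (tail M))) (columns-cong (tail (tail M))) ⟩
    0#
      ∎
    where
    D : Fin (suc (suc n)) → Fin (suc n) → Carrier
    D j k = columns (tail (tail M)) (punchIn j ∘ punchIn k)
  detFin-head-equal {suc n} M (suc i) M₀≈Mᵢ = begin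
    detFin (suc (suc n)) M
      ≈⟨ +-identityʳ _ ⟨
    detFin (suc (suc n)) M + 0#
      ≈⟨ +-congˡ (minors≈0⇒detFin≈0 (swapTop M)
           (λ j → detFin-head-equal (minor (swapTop M) j) i (λ k → M₀≈Mᵢ (punchIn j k)))) ⟨
    detFin (suc (suc n)) M + detFin (suc (suc n)) (swapTop M)
      ≈⟨ detFin-swapTop M ⟩
    0#
      ∎

  detFin-equal-rows : ∀ {n} (M : Square n) i j → i ≢ j →
    (∀ k → M i k ≈ M j k) → detFin n M ≈ 0#
  detFin-equal-rows {suc n} M zero    zero    i≢j Mᵢ≈Mⱼ = contradiction ≡.refl i≢j
  detFin-equal-rows {suc n} M zero    (suc j) i≢j Mᵢ≈Mⱼ = detFin-head-equal M j Mᵢ≈Mⱼ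
  detFin-equal-rows {suc n} M (suc i) zero    i≢j Mᵢ≈Mⱼ = detFin-head-equal M i (sym ∘ Mᵢ≈Mⱼ)
  detFin-equal-rows {suc n} M (suc i) (suc j) i≢j Mᵢ≈Mⱼ = minors≈0⇒detFin≈0 M λ l →
    detFin-equal-rows (minor M l) i j (i≢j ∘ cong suc) (Mᵢ≈Mⱼ ∘ punchIn l)

  -- Row operations.

  -- Induction on the number of added rows. Linearity splits off the first summand as a multiple of
  -- the determinant with row `τ zero` in place of row `i`; that matrix has two equal rows because
  -- `τ zero ≢ i`.
  detFin-add-rows : ∀ {a n} (τ : Fin a → Fin n) (y : Fin a → Carrier) (i : Fin n) →
    (∀ l → τ l ≢ i) → {M M′ : Square n} →
    (∀ k → M′ i k ≈ M i k + sum λ l → y l * M (τ l) k) →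
    (∀ j → j ≢ i → ∀ k → M′ j k ≈ M j k) →
    detFin n M′ ≈ detFin n M
  detFin-add-rows {zero} {n} τ y i τ≢i {M} {M′} M′ᵢ M′≈M = detFin-cong rows
    where
    rows : ∀ j k → M′ j k ≈ M j k
    rows j k with j ≟ i
    ... | yes ≡.refl = trans (M′ᵢ k) (+-identityʳ _)
    ... | no j≢i     = M′≈M j j≢i k
  detFin-add-rows {suc a} {n} τ y i τ≢i {M} {M′} M′ᵢ M′≈M = begin
    detFin n M′
      ≈⟨ detFin-linear i (y zero)
           (λ k → begin
             M′ i k
               ≈⟨ M′ᵢ k ⟩
             M i k + (y zero * M (τ zero) k + sum λ l → y (suc l) * M (τ (suc l)) k)
               ≈⟨ x∙yz≈y∙xz⁺ _ _ _ ⟩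
             y zero * M (τ zero) k + (M i k + sum λ l → y (suc l) * M (τ (suc l)) k)
               ≈⟨ +-cong (*-congˡ (replaced (M (τ zero)) k)) (replaced shorter k) ⟨
             y zero * replace (M (τ zero)) i k + replace shorter i k
               ∎)
           (λ j j≢i k → trans (M′≈M j j≢i k) (sym (kept (M (τ zero)) j j≢i k)))
           (λ j j≢i k → trans (M′≈M j j≢i k) (sym (kept shorter j j≢i k))) ⟩
    y zero * detFin n (replace (M (τ zero))) + detFin n (replace shorter)
      ≈⟨ +-cong
           (*-congˡ (detFin-equal-rows _ i (τ zero) (τ≢i zero ∘ ≡.sym) λ k →
             trans (replaced (M (τ zero)) k) (sym (kept (M (τ zero)) (τ zero) (τ≢i zero) k))))
           (detFin-add-rows (τ ∘ suc) (y ∘ suc) i (τ≢i ∘ suc) (replaced shorter) (kept shorter)) ⟩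
    y zero * 0# + detFin n M
      ≈⟨ trans (+-congʳ (zeroʳ _)) (+-identityˡ _) ⟩
    detFin n M
      ∎
    where
    open CommutativeSemigroupProperties +-commutativeSemigroup using () renaming (x∙yz≈y∙xz to x∙yz≈y∙xz⁺)

    shorter : Fin n → Carrier
    shorter k = M i k + sum λ l → y (suc l) * M (τ (suc l)) k

    replace : (Fin n → Carrier) → Square n
    replace r = updateAt M i (λ _ → r)

    replaced : ∀ r k → replace r i k ≈ r k
    replaced r k = reflexive (cong-app (updateAt-updates i M) k)

    kept : ∀ r j → j ≢ i → ∀ k → replace r j k ≈ M j k
    kept r j j≢i k = reflexive (cong-app (updateAt-minimal j i M j≢i) k)

  -- The rows are exchanged one at a time, from the first on. Stating this for an arbitrary `f` lets
  -- the induction fix the new first row and continue with `f ∘ (head M′ ◂_)`. Each step knows that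
  -- every row comes from `M` or `M′` and that the row in question is still that of `M`.
  replace-rows : ∀ {a} {A : Set a} {n} (f : (Fin n → A) → Carrier) →
    (∀ {X Y} → X ≗ Y → f X ≈ f Y) → (M M′ : Fin n → A) →
    (∀ X i → (∀ j → X j ≡ M j ⊎ X j ≡ M′ j) → X i ≡ M i →
      f (updateAt X i λ _ → M′ i) ≈ f X) →
    f M′ ≈ f M
  replace-rows {n = zero}  f f-cong M M′ step = f-cong λ ()
  replace-rows {n = suc n} f f-cong M M′ step = begin
    f M′
      ≈⟨ f-cong (λ { zero → ≡.refl ; (suc i) → ≡.refl }) ⟩
    f (head M′ ◂ tail M′)
      ≈⟨ replace-rows (f ∘ (head M′ ◂_))
           (λ X≗Y → f-cong λ { zero → ≡.refl ; (suc i) → X≗Y i })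
           (tail M) (tail M′)
           (λ X i mixed Xᵢ → trans
             (f-cong λ { zero → ≡.refl ; (suc j) → ≡.refl })
             (step (head M′ ◂ X) (suc i) (λ { zero → inj₂ ≡.refl ; (suc j) → mixed j }) Xᵢ)) ⟩
    f (head M′ ◂ tail M)
      ≈⟨ f-cong (λ { zero → ≡.refl ; (suc i) → ≡.refl }) ⟩
    f (updateAt M zero λ _ → M′ zero)
      ≈⟨ step M zero (λ _ → inj₁ ≡.refl) ≡.refl ⟩
    f M
      ∎

  -- The pivot rows `τ l` agree in `M` and `M′`, hence also in every mixture of the two. A
  -- combination of pivot rows taken in `M` is therefore the same combination at each intermediate
  -- stage.
  detFin-row-operations : ∀ {a n} (τ : Fin a → Fin n) (M M′ : Square n) →
    (∀ l k → M′ (τ l) k ≈ M (τ l) k) →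
    (∀ i → (∀ k → M′ i k ≈ M i k) ⊎
           ((∀ l → τ l ≢ i) × ∃ λ y → ∀ k → M′ i k ≈ M i k + sum λ l → y l * M (τ l) k)) →
    detFin n M′ ≈ detFin n M
  detFin-row-operations {a} {n} τ M M′ pivot change =
    replace-rows (detFin n) (λ X≗Y → detFin-cong λ i k → reflexive (cong-app (X≗Y i) k)) M M′ step
    where
    step : ∀ X i → (∀ j → X j ≡ M j ⊎ X j ≡ M′ j) → X i ≡ M i →
      detFin n (updateAt X i λ _ → M′ i) ≈ detFin n X
    step X i mixed Xᵢ = [ unchanged , combined ]′ (change i)
      where
      updated : ∀ k → updateAt X i (λ _ → M′ i) i k ≈ M′ i k
      updated k = reflexive (cong-app (updateAt-updates i X) k)

      kept : ∀ j → j ≢ i → ∀ k → updateAt X i (λ _ → M′ i) j k ≈ X j k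
      kept j j≢i k = reflexive (cong-app (updateAt-minimal j i X j≢i) k)

      row : ∀ k → X i k ≈ M i k
      row k = reflexive (cong-app Xᵢ k)

      pivot-row : ∀ l k → X (τ l) k ≈ M (τ l) k
      pivot-row l k with mixed (τ l)
      ... | inj₁ X≡M  = reflexive (cong-app X≡M k)
      ... | inj₂ X≡M′ = trans (reflexive (cong-app X≡M′ k)) (pivot l k)

      combined : ((∀ l → τ l ≢ i) × ∃ λ y → ∀ k → M′ i k ≈ M i k + sum λ l → y l * M (τ l) k) →
        detFin n (updateAt X i λ _ → M′ i) ≈ detFin n X
      combined (τ≢i , y , M′ᵢ) = detFin-add-rows τ y i τ≢i
        (λ k → trans (updated k) (trans (M′ᵢ k) (sym (+-cong (row k)
          (sum-cong-≋ λ l → *-congˡ (pivot-row l k))))))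
        kept

      unchanged : (∀ k → M′ i k ≈ M i k) → detFin n (updateAt X i λ _ → M′ i) ≈ detFin n X
      unchanged M′ᵢ≈Mᵢ = detFin-cong rows
        where
        rows : ∀ j k → updateAt X i (λ _ → M′ i) j k ≈ X j k
        rows j k with j ≟ i
        ... | yes ≡.refl = trans (updated k) (trans (M′ᵢ≈Mᵢ k) (sym (row k)))
        ... | no j≢i     = kept j j≢i k

  -- Kronecker delta and indices of block matrices.

  δ : ∀ {n} → Square n
  δ i j = if does (i ≟ j) then 1# else 0#

  sum-*-δ : ∀ {n} (f : Fin n → Carrier) j → sum (λ l → f l * δ l j) ≈ f j
  sum-*-δ {suc n} f zero = begin
    f zero * 1# + sum (λ l → f (suc l) * 0#)
      ≈⟨ +-cong (*-identityʳ _) (sum-cong-≋ {n} λ l → zeroʳ _) ⟩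
    f zero + sum {n} (λ _ → 0#)
      ≈⟨ +-congˡ (sum-replicate-zero n) ⟩
    f zero + 0#
      ≈⟨ +-identityʳ _ ⟩
    f zero
      ∎
  sum-*-δ {suc n} f (suc j) = begin
    f zero * 0# + sum (λ l → f (suc l) * δ l j)  ≈⟨ +-cong (zeroʳ _) (sum-*-δ (f ∘ suc) j) ⟩
    0# + f (suc j)                               ≈⟨ +-identityˡ _ ⟩
    f (suc j)                                    ∎

  sum-neg : ∀ {n} (f g : Fin n → Carrier) →
    sum (λ l → - f l * g l) ≈ - sum (λ l → f l * g l)
  sum-neg {zero}  f g = sym -0#≈0#
  sum-neg {suc n} f g = trans
    (+-cong (sym (-‿distribˡ-* _ _)) (sum-neg (f ∘ suc) (g ∘ suc)))
    (-‿+-comm _ _)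

  ↑-elim : ∀ {p} n {m} (P : Fin (n ℕ.+ m) → Set p) →
    (∀ i → P (i ↑ˡ m)) → (∀ j → P (n ↑ʳ j)) → ∀ k → P k
  ↑-elim zero    P Pˡ Pʳ k       = Pʳ k
  ↑-elim (suc n) P Pˡ Pʳ zero    = Pˡ zero
  ↑-elim (suc n) P Pˡ Pʳ (suc k) = ↑-elim n (P ∘ suc) (Pˡ ∘ suc) Pʳ k

  ↑ˡ≢↑ʳ : ∀ {n m} (i : Fin n) (j : Fin m) → i ↑ˡ m ≢ n ↑ʳ j
  ↑ˡ≢↑ʳ (suc i) j eq = ↑ˡ≢↑ʳ i j (suc-injective eq)

  -- With `punchIn-↑ʳ` this shows that removing a column of the left part keeps the block form: the
  -- left part loses that column and the right part keeps all of its own.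
  punchIn-↑ˡ : ∀ {n} m (j : Fin (suc n)) (k : Fin n) →
    punchIn (j ↑ˡ m) (k ↑ˡ m) ≡ punchIn j k ↑ˡ m
  punchIn-↑ˡ m zero    k       = ≡.refl
  punchIn-↑ˡ m (suc j) zero    = ≡.refl
  punchIn-↑ˡ m (suc j) (suc k) = cong suc (punchIn-↑ˡ m j k)

  punchIn-↑ʳ : ∀ {n m} (j : Fin (suc n)) (k : Fin m) →
    punchIn (j ↑ˡ m) (n ↑ʳ k) ≡ suc n ↑ʳ k
  punchIn-↑ʳ         zero    k = ≡.refl
  punchIn-↑ʳ {suc n} (suc j) k = cong suc (punchIn-↑ʳ j k)

  -- The left indices come first, so dropping the right ones does not alter their signs.
  ±∑-↑ˡ : ∀ n {m} (f : Fin (n ℕ.+ m) → Carrier) →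
    (∀ j → f (n ↑ʳ j) ≈ 0#) → ±∑ f ≈ ±∑ (λ i → f (i ↑ˡ m))
  ±∑-↑ˡ zero    f f≈0 = trans (±∑-zero f≈0) (sym (±∑-zero λ ()))
  ±∑-↑ˡ (suc n) f f≈0 = begin
    ±∑ f                                    ≈⟨ ±∑-suc f ⟩
    f zero + - ±∑ (f ∘ suc)                 ≈⟨ +-congˡ (-‿cong (±∑-↑ˡ n (f ∘ suc) f≈0)) ⟩
    f zero + - ±∑ (λ i → f (suc (i ↑ˡ _)))  ≈⟨ ±∑-suc _ ⟨
    ±∑ (λ i → f (i ↑ˡ _))                   ∎

  -- Determinants of block triangular matrices.

  -- In the expansion along the top row, the term of column `zero` has coefficient zero, and every
  -- other minor still contains the zero column.
  detFin-zero-column : ∀ {n} (M : Square (suc n)) → (∀ i → M i zero ≈ 0#) → detFin (suc n) M ≈ 0#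
  detFin-zero-column {n} M M₀≈0 = trans (detFin-expand M) (±∑-zero (terms n M M₀≈0))
    where
    terms : ∀ n (M : Square (suc n)) → (∀ i → M i zero ≈ 0#) →
      ∀ j → M zero j * detFin n (minor M j) ≈ 0#
    terms n       M M₀≈0 zero    = trans (*-congʳ (M₀≈0 zero)) (zeroˡ _)
    terms (suc n) M M₀≈0 (suc j) =
      trans (*-congˡ (detFin-zero-column (minor M (suc j)) (M₀≈0 ∘ suc))) (zeroʳ _)

  detFin-pivot : ∀ {n} (M : Square (suc n)) → (∀ i → M (suc i) zero ≈ 0#) →
    detFin (suc n) M ≈ M zero zero * detFin n (minor M zero)
  detFin-pivot {n} M M₀≈0 = begin
    detFin (suc n) M
      ≈⟨ detFin-expand M ⟩
    ±∑ (λ j → M zero j * detFin n (minor M j))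
      ≈⟨ ±∑-suc _ ⟩
    M zero zero * detFin n (minor M zero) + - ±∑ (λ j → M zero (suc j) * detFin n (minor M (suc j)))
      ≈⟨ +-congˡ (trans (-‿cong (±∑-zero (terms n M M₀≈0))) -0#≈0#) ⟩
    M zero zero * detFin n (minor M zero) + 0#
      ≈⟨ +-identityʳ _ ⟩
    M zero zero * detFin n (minor M zero)
      ∎
    where
    terms : ∀ n (M : Square (suc n)) → (∀ i → M (suc i) zero ≈ 0#) →
      ∀ j → M zero (suc j) * detFin n (minor M (suc j)) ≈ 0#
    terms (suc n) M M₀≈0 j =
      trans (*-congˡ (detFin-zero-column (minor M (suc j)) M₀≈0)) (zeroʳ _)

  -- The first column is `x` on top of zeros, so each pivot step splits off one factor `x` and
  -- leaves a matrix of the same shape.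
  detFin-block-upper : ∀ n {m} x (M : Square (n ℕ.+ m)) →
    (∀ i j → M (i ↑ˡ m) (j ↑ˡ m) ≈ x * δ i j) →
    (∀ i j → M (n ↑ʳ i) (j ↑ˡ m) ≈ 0#) →
    detFin (n ℕ.+ m) M ≈ x ** n * detFin m (λ i j → M (n ↑ʳ i) (n ↑ʳ j))
  detFin-block-upper zero        x M M≈xδ M≈0 = sym (*-identityˡ _)
  detFin-block-upper (suc n) {m} x M M≈xδ M≈0 = begin
    detFin (suc n ℕ.+ m) M
      ≈⟨ detFin-pivot M (↑-elim n (λ k → M (suc k) zero ≈ 0#)
           (λ i → trans (M≈xδ (suc i) zero) (zeroʳ x)) (λ i → M≈0 i zero)) ⟩
    M zero zero * detFin (n ℕ.+ m) (minor M zero)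
      ≈⟨ *-cong (trans (M≈xδ zero zero) (*-identityʳ x))
           (detFin-block-upper n x (minor M zero)
             (λ i j → M≈xδ (suc i) (suc j)) (λ i j → M≈0 i (suc j))) ⟩
    x * (x ** n * detFin m (λ i j → M (suc n ↑ʳ i) (suc n ↑ʳ j)))
      ≈⟨ *-assoc _ _ _ ⟨
    x ** suc n * detFin m (λ i j → M (suc n ↑ʳ i) (suc n ↑ʳ j))
      ∎

  detFin-identity : ∀ {n} (M : Square n) → (∀ i j → M i j ≈ δ i j) → detFin n M ≈ 1#
  detFin-identity {zero}  M M≈δ = refl
  detFin-identity {suc n} M M≈δ = begin
    detFin (suc n) M
      ≈⟨ detFin-pivot M (λ i → M≈δ (suc i) zero) ⟩
    M zero zero * detFin n (minor M zero)
      ≈⟨ *-cong (M≈δ zero zero) (detFin-identity (minor M zero) λ i j → M≈δ (suc i) (suc j)) ⟩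
    1# * 1#
      ≈⟨ *-identityˡ 1# ⟩
    1#
      ∎

  -- The top row vanishes on the right, so only left columns contribute and their minors have the
  -- same shape. After `n` rows the identity block remains, with determinant one.
  detFin-block-lower : ∀ n {m} (M : Square (n ℕ.+ m)) →
    (∀ i j → M (i ↑ˡ m) (n ↑ʳ j) ≈ 0#) →
    (∀ i j → M (n ↑ʳ i) (n ↑ʳ j) ≈ δ i j) →
    detFin (n ℕ.+ m) M ≈ detFin n (λ i j → M (i ↑ˡ m) (j ↑ˡ m))
  detFin-block-lower zero        M M≈0 M≈δ = detFin-identity M M≈δ
  detFin-block-lower (suc n) {m} M M≈0 M≈δ = begin
    detFin (suc n ℕ.+ m) M
      ≈⟨ detFin-expand M ⟩
    ±∑ (λ j → M zero j * detFin (n ℕ.+ m) (minor M j))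
      ≈⟨ ±∑-↑ˡ (suc n) _ (λ j → trans (*-congʳ (M≈0 zero j)) (zeroˡ _)) ⟩
    ±∑ (λ j → M zero (j ↑ˡ m) * detFin (n ℕ.+ m) (minor M (j ↑ˡ m)))
      ≈⟨ ±∑-cong (λ j → *-congˡ (trans
           (detFin-block-lower n (minor M (j ↑ˡ m))
             (λ i k → trans (reflexive (cong (M _) (punchIn-↑ʳ j k))) (M≈0 (suc i) k))
             (λ i k → trans (reflexive (cong (M _) (punchIn-↑ʳ j k))) (M≈δ i k)))
           (detFin-cong λ i k → reflexive (cong (M _) (punchIn-↑ˡ m j k))))) ⟩
    ±∑ (λ j → M zero (j ↑ˡ m) * detFin n (minor (λ i k → M (i ↑ˡ m) (k ↑ˡ m)) j))
      ≈⟨ detFin-expand (λ i k → M (i ↑ˡ m) (k ↑ˡ m)) ⟨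
    detFin (suc n) (λ i j → M (i ↑ˡ m) (j ↑ˡ m))
      ∎

  -- Scaling of rows.

  detFin-scale : ∀ {n} x (M M′ : Square n) →
    (∀ i k → M′ i k ≈ x * M i k) → detFin n M′ ≈ x ** n * detFin n M
  detFin-scale {zero}  x M M′ M′≈xM = sym (*-identityˡ 1#)
  detFin-scale {suc n} x M M′ M′≈xM = begin
    detFin (suc n) M′
      ≈⟨ detFin-expand M′ ⟩
    ±∑ (λ j → M′ zero j * detFin n (minor M′ j))
      ≈⟨ ±∑-cong (λ j → trans
           (*-cong (M′≈xM zero j) (detFin-scale x (minor M j) (minor M′ j) λ i k → M′≈xM (suc i) (punchIn j k)))
           (*-interchange _ _ _ _)) ⟩
    ±∑ (λ j → x ** suc n * (M zero j * detFin n (minor M j)))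
      ≈⟨ *-distribˡ-±∑ _ _ ⟨
    x ** suc n * ±∑ (λ j → M zero j * detFin n (minor M j))
      ≈⟨ *-congˡ (detFin-expand M) ⟨
    x ** suc n * detFin (suc n) M
      ∎

  -- Expansion along the unscaled top rows leaves minors formed from bottom rows only, where
  -- `detFin-scale` applies.
  detFin-scale-bottom : ∀ n {m} x (M M′ : Square (n ℕ.+ m)) →
    (∀ i k → M′ (i ↑ˡ m) k ≈ M (i ↑ˡ m) k) →
    (∀ i k → M′ (n ↑ʳ i) k ≈ x * M (n ↑ʳ i) k) →
    detFin (n ℕ.+ m) M′ ≈ x ** m * detFin (n ℕ.+ m) M
  detFin-scale-bottom zero        x M M′ top bottom = detFin-scale x M M′ bottom
  detFin-scale-bottom (suc n) {m} x M M′ top bottom = begin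
    detFin (suc n ℕ.+ m) M′
      ≈⟨ detFin-expand M′ ⟩
    ±∑ (λ j → M′ zero j * detFin (n ℕ.+ m) (minor M′ j))
      ≈⟨ ±∑-cong (λ j → trans
           (*-cong (top zero j) (detFin-scale-bottom n x (minor M j) (minor M′ j)
             (λ i k → top (suc i) (punchIn j k)) (λ i k → bottom i (punchIn j k))))
           (x∙yz≈y∙xz _ _ _)) ⟩
    ±∑ (λ j → x ** m * (M zero j * detFin (n ℕ.+ m) (minor M j)))
      ≈⟨ *-distribˡ-±∑ _ _ ⟨
    x ** m * ±∑ (λ j → M zero j * detFin (n ℕ.+ m) (minor M j))
      ≈⟨ *-congˡ (detFin-expand M) ⟨
    x ** m * detFin (suc n ℕ.+ m) M
      ∎

  -- Block matrices and the exchange of the two factors.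

  blocks : ∀ {n m} → (Fin n → Fin n → Carrier) → (Fin n → Fin m → Carrier) →
           (Fin m → Fin n → Carrier) → (Fin m → Fin m → Carrier) → Square (n ℕ.+ m)
  blocks P Q S T = (λ i → P i ++ Q i) ++ (λ i → S i ++ T i)

  module _ {n m : ℕ} {P : Fin n → Fin n → Carrier} {Q : Fin n → Fin m → Carrier}
                     {S : Fin m → Fin n → Carrier} {T : Fin m → Fin m → Carrier} where

    blocks-ˡ : ∀ i → blocks P Q S T (i ↑ˡ m) ≡ P i ++ Q i
    blocks-ˡ = lookup-++ˡ (λ i → P i ++ Q i) (λ i → S i ++ T i)

    blocks-ʳ : ∀ i → blocks P Q S T (n ↑ʳ i) ≡ S i ++ T i
    blocks-ʳ = lookup-++ʳ (λ i → P i ++ Q i) (λ i → S i ++ T i)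

    blocks-ˡˡ : ∀ i j → blocks P Q S T (i ↑ˡ m) (j ↑ˡ m) ≈ P i j
    blocks-ˡˡ i j = reflexive (≡.trans (cong-app (blocks-ˡ i) _) (lookup-++ˡ (P i) (Q i) j))

    blocks-ˡʳ : ∀ i j → blocks P Q S T (i ↑ˡ m) (n ↑ʳ j) ≈ Q i j
    blocks-ˡʳ i j = reflexive (≡.trans (cong-app (blocks-ˡ i) _) (lookup-++ʳ (P i) (Q i) j))

    blocks-ʳˡ : ∀ i j → blocks P Q S T (n ↑ʳ i) (j ↑ˡ m) ≈ S i j
    blocks-ʳˡ i j = reflexive (≡.trans (cong-app (blocks-ʳ i) _) (lookup-++ˡ (S i) (T i) j))

    blocks-ʳʳ : ∀ i j → blocks P Q S T (n ↑ʳ i) (n ↑ʳ j) ≈ T i j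
    blocks-ʳʳ i j = reflexive (≡.trans (cong-app (blocks-ʳ i) _) (lookup-++ʳ (S i) (T i) j))

  blocks-cong-ˡ : ∀ {n m} {P : Fin n → Fin n → Carrier} {Q : Fin n → Fin m → Carrier} {S S′ T T′} →
    ∀ i k → blocks P Q S T (i ↑ˡ m) k ≈ blocks P Q S′ T′ (i ↑ˡ m) k
  blocks-cong-ˡ i k = reflexive (cong-app (≡.trans (blocks-ˡ i) (≡.sym (blocks-ˡ i))) k)

  blocks-cong-ʳ : ∀ {n m} {P P′ Q Q′} {S : Fin m → Fin n → Carrier} {T : Fin m → Fin m → Carrier} →
    ∀ i k → blocks P Q S T (n ↑ʳ i) k ≈ blocks P′ Q′ S T (n ↑ʳ i) k
  blocks-cong-ʳ i k = reflexive (cong-app (≡.trans (blocks-ʳ i) (≡.sym (blocks-ʳ i))) k)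

  scalar : ∀ {n} → Carrier → Square n
  scalar x i j = x * δ i j

  characteristicMatrix : ∀ {n m} → Carrier → (Fin n → Fin m → Carrier) → (Fin m → Fin n → Carrier) → Square n
  characteristicMatrix x A B i j = scalar x i j + - sum λ k → A i k * B k j

  detFin-char-swap : ∀ {n m} x (A : Fin n → Fin m → Carrier) (B : Fin m → Fin n → Carrier) →
    x ** m * detFin n (characteristicMatrix x A B) ≈ x ** n * detFin m (characteristicMatrix x B A)
  detFin-char-swap {n} {m} x A B = begin
    x ** m * detFin n (characteristicMatrix x A B)
      ≈⟨ *-congˡ (detFin-cong {n} (blocks-ˡˡ {n})) ⟨
    x ** m * detFin n (λ i j → K₁ (i ↑ˡ m) (j ↑ˡ m))
      ≈⟨ *-congˡ (detFin-block-lower n K₁ (blocks-ˡʳ {n}) (blocks-ʳʳ {n})) ⟨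
    x ** m * detFin (n ℕ.+ m) K₁
      ≈⟨ *-congˡ (detFin-row-operations (n ↑ʳ_) K K₁ (blocks-cong-ʳ {n})
           (↑-elim n _
             (λ i → inj₂ ((λ l eq → ↑ˡ≢↑ʳ i l (≡.sym eq)) , (λ l → - A i l) , top i))
             (λ i → inj₁ (blocks-cong-ʳ {n} i)))) ⟩
    x ** m * detFin (n ℕ.+ m) K
      -- By definition `scalar x` is `x` times `δ`, so both bottom blocks of `K₂` are `x` times
      -- those of `K`, entry by entry.
      ≈⟨ detFin-scale-bottom n x K K₂ (blocks-cong-ˡ {n}) (λ i → ↑-elim n _
           (λ k → trans (blocks-ʳˡ {n} i k) (*-congˡ (sym (blocks-ʳˡ {n} i k))))
           (λ k → trans (blocks-ʳʳ {n} i k) (*-congˡ (sym (blocks-ʳʳ {n} i k))))) ⟨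
    detFin (n ℕ.+ m) K₂
      ≈⟨ detFin-row-operations (_↑ˡ m) K₂ K₃ (blocks-cong-ˡ {n})
           (↑-elim n _
             (λ i → inj₁ (blocks-cong-ˡ {n} i))
             (λ i → inj₂ ((λ l → ↑ˡ≢↑ʳ l i) , (λ l → - B i l) , bottom i))) ⟨
    detFin (n ℕ.+ m) K₃
      ≈⟨ detFin-block-upper n x K₃ (blocks-ˡˡ {n}) (blocks-ʳˡ {n}) ⟩
    x ** n * detFin m (λ i j → K₃ (n ↑ʳ i) (n ↑ʳ j))
      ≈⟨ *-congˡ (detFin-cong {m} (blocks-ʳʳ {n})) ⟩
    x ** n * detFin m (characteristicMatrix x B A)
      ∎
    where
    O : ∀ {a b} → Fin a → Fin b → Carrier
    O i j = 0#

    K K₁ K₂ K₃ : Square (n ℕ.+ m)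
    K  = blocks (scalar x) A B δ
    K₁ = blocks (characteristicMatrix x A B) O B δ
    K₂ = blocks (scalar x) A (λ i j → x * B i j) (scalar x)
    K₃ = blocks (scalar x) A O (characteristicMatrix x B A)

    top : ∀ i k → K₁ (i ↑ˡ m) k ≈ K (i ↑ˡ m) k + sum λ l → - A i l * K (n ↑ʳ l) k
    top i = ↑-elim n _
      (λ k → begin
        K₁ (i ↑ˡ m) (k ↑ˡ m)
          ≈⟨ blocks-ˡˡ {n} i k ⟩
        scalar x i k + - sum (λ l → A i l * B l k)
          ≈⟨ +-congˡ (sum-neg {m} _ _) ⟨
        scalar x i k + sum (λ l → - A i l * B l k)
          ≈⟨ +-cong (blocks-ˡˡ {n} i k) (sum-cong-≋ {m} λ l → *-congˡ (blocks-ʳˡ {n} l k)) ⟨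
        K (i ↑ˡ m) (k ↑ˡ m) + sum (λ l → - A i l * K (n ↑ʳ l) (k ↑ˡ m))
          ∎)
      (λ k → begin
        K₁ (i ↑ˡ m) (n ↑ʳ k)
          ≈⟨ blocks-ˡʳ {n} i k ⟩
        0#
          ≈⟨ -‿inverseʳ (A i k) ⟨
        A i k + - A i k
          -- The lower right block of `K` is `δ`, so the added rows contribute exactly `- A i k`
          -- here.
          ≈⟨ +-congˡ (sum-*-δ (λ l → - A i l) k) ⟨
        A i k + sum (λ l → - A i l * δ l k)
          ≈⟨ +-cong (blocks-ˡʳ {n} i k) (sum-cong-≋ {m} λ l → *-congˡ (blocks-ʳʳ {n} l k)) ⟨
        K (i ↑ˡ m) (n ↑ʳ k) + sum (λ l → - A i l * K (n ↑ʳ l) (n ↑ʳ k))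
          ∎)

    bottom : ∀ i k → K₃ (n ↑ʳ i) k ≈ K₂ (n ↑ʳ i) k + sum λ l → - B i l * K₂ (l ↑ˡ m) k
    bottom i = ↑-elim n _
      (λ k → begin
        K₃ (n ↑ʳ i) (k ↑ˡ m)
          ≈⟨ blocks-ʳˡ {n} i k ⟩
        0#
          ≈⟨ -‿inverseʳ (x * B i k) ⟨
        x * B i k + - (x * B i k)
          ≈⟨ +-congˡ (trans (-‿distribʳ-* _ _) (*-comm _ _)) ⟩
        x * B i k + - B i k * x
          -- The upper left block of `K₂` is `x` times `δ`, so the added rows contribute
          -- `- B i k * x`, which cancels the scaled entry `x * B i k`.
          ≈⟨ +-congˡ (sum-*-δ (λ l → - B i l * x) k) ⟨
        x * B i k + sum (λ l → - B i l * x * δ l k)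
          ≈⟨ +-cong (blocks-ʳˡ {n} i k) (sum-cong-≋ {n} λ l →
               trans (*-congˡ (blocks-ˡˡ {n} l k)) (sym (*-assoc _ _ _))) ⟨
        K₂ (n ↑ʳ i) (k ↑ˡ m) + sum (λ l → - B i l * K₂ (l ↑ˡ m) (k ↑ˡ m))
          ∎)
      (λ k → begin
        K₃ (n ↑ʳ i) (n ↑ʳ k)
          ≈⟨ blocks-ʳʳ {n} i k ⟩
        scalar x i k + - sum (λ l → B i l * A l k)
          ≈⟨ +-congˡ (sum-neg {n} _ _) ⟨
        scalar x i k + sum (λ l → - B i l * A l k)
          ≈⟨ +-cong (blocks-ʳʳ {n} i k) (sum-cong-≋ {n} λ l → *-congˡ (blocks-ˡʳ {n} l k)) ⟨
        K₂ (n ↑ʳ i) (n ↑ʳ k) + sum (λ l → - B i l * K₂ (l ↑ˡ m) (n ↑ʳ k))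
          ∎)

-- Application to characteristic polynomials and Laplacians.

open IntegerPolynomials using (ℤ[x]-commutativeRing; ⊕-cong; ⊖-cong; ⊛-cong; ∷-cong)
open CommutativeRing ℤ[x]-commutativeRing using (setoid; reflexive; *-congˡ; refl)
open Determinants ℤ[x]-commutativeRing using (δ; characteristicMatrix; detFin-cong; detFin-char-swap)
open SetoidReasoning setoid

module ∑ℤ = RawMonoidDefs ℤ.+-0-rawMonoid
module ∑ℤ[x] = RawMonoidDefs (RawRing.+-rawMonoid ℤ[x])

const-* : ∀ a b → const (a ℤ.* b) ≋ const a ⊛ const b
const-* a b = ∷-cong (≡.sym (ℤ.+-identityʳ _)) refl

-- Carries an entry of an integer matrix product over to ℤ[x]. On sums `const` is additive by
-- computation, except that the empty sum gives `0ℤ ∷ []` on one side and `[]` on the other.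
const-∑-* : ∀ {n} (f g : Fin n → ℤ) →
  const (∑ℤ.sum λ k → f k ℤ.* g k) ≋ ∑ℤ[x].sum λ k → const (f k) ⊛ const (g k)
const-∑-* {zero}  f g = IntegerPolynomials.0∷[]≋[]
const-∑-* {suc n} f g = ⊕-cong (const-* (f zero) (g zero)) (const-∑-* (f ∘ suc) (g ∘ suc))

-- Equality in `Elem A` is decided by comparing indices, and the index of `element i` is `i`.
identity≡δ : ∀ A i j → let open FiniteSet A using (element) in
  Matℤ[x].identity A (element i) (element j) ≡ δ i j
identity≡δ A i j = cong₂ (λ k l → if does (k ≟ l) then const 1ℤ else [])
  (Inverse.strictlyInverseˡ (FiniteSet.index A) i)
  (Inverse.strictlyInverseˡ (FiniteSet.index A) j)

χ-cong : ∀ A {L L′ : Matℤ.Matrix A A} → (∀ a b → L a b ≡ L′ a b) → χ A L ≋ χ A L′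
χ-cong A L≡L′ = detFin-cong λ i j → ⊕-cong
  (refl {x ⊛ Matℤ[x].identity A (element i) (element j)})
  (⊖-cong (reflexive (cong const (L≡L′ (element i) (element j)))))
  where open FiniteSet A using (element)

constMatrix : ∀ {A B} → Matℤ.Matrix A B → Fin ∣ A ∣ → Fin ∣ B ∣ → Poly
constMatrix {A} {B} M i k = const (M (FiniteSet.element A i) (FiniteSet.element B k))

χ-mul : ∀ {A B} (M : Matℤ.Matrix A B) (N : Matℤ.Matrix B A) →
  χ A (Matℤ.mul {A} {B} {A} M N) ≋
  Matℤ[x].detFin (∣ A ∣) (characteristicMatrix x (constMatrix {A} {B} M) (constMatrix {B} {A} N))
χ-mul {A} {B} M N = detFin-cong λ i j → ⊕-cong
  (⊛-cong (refl {x}) (reflexive (identity≡δ A i j)))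
  (⊖-cong (const-∑-* (λ k → M (element A i) (element B k)) (λ k → N (element B k) (element A j))))
  where open FiniteSet using (element)

χ-mul-swap : ∀ {A B} (M : Matℤ.Matrix A B) (N : Matℤ.Matrix B A) →
  x ^ ∣ B ∣ ⊛ χ A (Matℤ.mul {A} {B} {A} M N) ≋ x ^ ∣ A ∣ ⊛ χ B (Matℤ.mul {B} {A} {B} N M)
χ-mul-swap {A} {B} M N = begin
  x ^ ∣ B ∣ ⊛ χ A (Matℤ.mul {A} {B} {A} M N)
    ≈⟨ *-congˡ {x ^ ∣ B ∣} (χ-mul {A} {B} M N) ⟩
  x ^ ∣ B ∣ ⊛ Matℤ[x].detFin (∣ A ∣) (characteristicMatrix x M[x] N[x])
    ≈⟨ detFin-char-swap x M[x] N[x] ⟩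
  x ^ ∣ A ∣ ⊛ Matℤ[x].detFin (∣ B ∣) (characteristicMatrix x N[x] M[x])
    ≈⟨ *-congˡ {x ^ ∣ A ∣} (χ-mul {B} {A} N M) ⟨
  x ^ ∣ A ∣ ⊛ χ B (Matℤ.mul {B} {A} {B} N M)
    ∎
  where
  M[x] = constMatrix {A} {B} M
  N[x] = constMatrix {B} {A} N

sum-cong : ∀ {n} {f g : Fin n → ℤ} → f ≗ g → ∑ℤ.sum f ≡ ∑ℤ.sum g
sum-cong {zero}  f≗g = ≡.refl
sum-cong {suc n} f≗g = cong₂ ℤ._+_ (f≗g zero) (sum-cong (f≗g ∘ suc))

module _ (G : OrientedHypergraph) where
  open OrientedHypergraph G

  -- Duality exchanges the tests on port and attachment and keeps the signs, so only the order of a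
  -- conjunction changes.
  incidenceMatrix-dual : ∀ e v → incidenceMatrix (incidenceDual G) e v ≡ incidenceMatrix G v e
  incidenceMatrix-dual e v = sum-cong λ k → let i = FiniteSet.element I k in
    cong (λ b → if b then σ i ◃ 1 else 0ℤ)
      (∧-comm (does (FiniteSet._≟_ E (ω i) e)) (does (FiniteSet._≟_ V (ς i) v)))

  laplacian-dual : ∀ e f → laplacian (incidenceDual G) e f ≡
    Matℤ.mul {E} {V} {E} (Matℤ._ᵀ {V} {E} (incidenceMatrix G)) (incidenceMatrix G) e f
  laplacian-dual e f = sum-cong λ k → let v = FiniteSet.element V k in
    cong₂ ℤ._*_ (incidenceMatrix-dual e v) (incidenceMatrix-dual f v)

theorem3p2p6 : (G : OrientedHypergraph) → let open OrientedHypergraph G in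
    x ^ ∣ E ∣ ⊛ χ V (laplacian G) ≋ x ^ ∣ V ∣ ⊛ χ E (laplacian (incidenceDual G))
theorem3p2p6 G = begin
  x ^ ∣ E ∣ ⊛ χ V (laplacian G)
    ≈⟨ χ-mul-swap {V} {E} H Hᵀ ⟩
  x ^ ∣ V ∣ ⊛ χ E (Matℤ.mul {E} {V} {E} Hᵀ H)
    ≈⟨ *-congˡ {x ^ ∣ V ∣} (χ-cong E (laplacian-dual G)) ⟨
  x ^ ∣ V ∣ ⊛ χ E (laplacian (incidenceDual G))
    ∎
  where
  open OrientedHypergraph G
  H  = incidenceMatrix G
  Hᵀ = Matℤ._ᵀ {V} {E} H
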